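{- Let $\mathcal N$ be a regular map in class I such that $\mathrm{Aut}\,\mathcal N$ is almost simple. Then the map $\mathcal M=\mathcal N_{\Sigma^+}$ is in class III. (Equivalently: if $N$ is the map subgroup of $\mathcal N$, so that $N$ is a normal subgroup of $\Gamma$ with six distinct images under $\Sigma$ and $\Gamma/N$ is almost simple, then $N_{\Sigma^+}=\bigcap_{\sigma\in\Sigma^+}\sigma(N)$ is invariant under $\Sigma^+$ but not under $\Sigma$.)
   Context: Let $\Gamma=\langle R_0,R_1,R_2\mid R_0^2=R_1^2=R_2^2=(R_0R_2)^2=1\rangle$, the free product of the Klein four-group $V=\langle R_0,R_2\rangle$ and $C=\langle R_1\rangle\cong C_2$. Regular maps $\mathcal M$ on surfaces, up to isomorphism, are identified with normal subgroups $M$ of $\Gamma$ (the map subgroups), with $\mathrm{Aut}\,\mathcal M\cong\Gamma/M$; maps are without boundary and without free edges, i.e. $M$ contains no conjugate of $R_0$, $R_1$, $R_2$ or $R_0R_2$. Let $\Sigma\cong S_3$ be the group of the six automorphisms of $\Gamma$ that fix $R_1$ and permute the three involutions $R_0,R_2,R_0R_2$ of $V$. It acts on the normal subgroups of $\Gamma$, hence on regular maps; this is Wilson's group of map operations. Let $\Sigma^+\cong C_3$ be its subgroup of order $3$. A regular map with map subgroup $M$ is in class I if $M$ has six distinct images under $\Sigma$, and in class III if its $\Sigma$-orbit has exactly two elements, i.e. $M$ is invariant under $\Sigma^+$ but not under $\Sigma$. For a regular map $\mathcal N$ with map subgroup $N$, $\mathcal N_{\Sigma^+}$ denotes the regular map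 with map subgroup $N_{\Sigma^+}=\bigcap_{\sigma\in\Sigma^+}\sigma(N)$. A group $A$ is almost simple if it has a non-abelian simple normal subgroup $S$ such that $C_A(S)=1$. -}

module Defs where

open import Level using (0ℓ)
open import Algebra.Bundles using (Group)
open import Algebra.Morphism.Structures using (module GroupMorphisms)
import Algebra.Definitions as AlgDefs
import Algebra.Properties.Group as GroupProperties
import Algebra.Morphism.Construct.Composition as Composition
import Algebra.Morphism.Construct.Identity as Identity
open import Data.Fin.Base using (Fin)
open import Data.Fin.Patterns using (0F; 1F; 2F)
open import Data.Fin.Permutation
  using (Permutation′; permutation; _⟨$⟩ʳ_; _⟨$⟩ˡ_; _∘ₚ_)
  renaming (id to idₚ; inverseʳ to perm-inverseʳ)
open import Data.Nat.Base using (ℕ)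
open import Data.Product.Base using (Σ; ∃; _×_; _,_; proj₁; proj₂)
open import Data.Sum.Base using (_⊎_)
open import Function.Base using (id; _∘_)
open import Relation.Binary.Core using (Rel)
open import Relation.Binary.PropositionalEquality.Core as ≡ using (_≡_; _≢_)
open import Relation.Nullary.Negation.Core using (¬_)
open import Relation.Unary using (Pred; _∈_; _≐_; U)
import Relation.Binary.Reasoning.Setoid as ≈-Reasoning

record IsSubgroup (G : Group 0ℓ 0ℓ) (H : Pred (Group.Carrier G) 0ℓ) : Set where
  open Group G
  field
    resp      : ∀ {x y} → x ≈ y → x ∈ H → y ∈ H
    ε-closed  : ε ∈ H
    ∙-closed  : ∀ {x y} → x ∈ H → y ∈ H → x ∙ y ∈ H
    ⁻¹-closed : ∀ {x} → x ∈ H → x ⁻¹ ∈ H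

record NormalSubgroup (G : Group 0ℓ 0ℓ) : Set₁ where
  open Group G
  field
    member      : Pred Carrier 0ℓ
    isSubgroup  : IsSubgroup G member
    conj-closed : ∀ g {x} → x ∈ member → g ∙ x ∙ g ⁻¹ ∈ member
  open IsSubgroup isSubgroup public

open NormalSubgroup using (member)

subgroup : (G : Group 0ℓ 0ℓ) {H : Pred (Group.Carrier G) 0ℓ} → IsSubgroup G H → Group 0ℓ 0ℓ
subgroup G {H} isSub = record
  { Carrier = Σ Carrier H
  ; _≈_     = λ x y → proj₁ x ≈ proj₁ y
  ; _∙_     = λ x y → proj₁ x ∙ proj₁ y , ∙-closed (proj₂ x) (proj₂ y)
  ; ε       = ε , ε-closed
  ; _⁻¹     = λ x → proj₁ x ⁻¹ , ⁻¹-closed (proj₂ x)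
  ; isGroup = record
    { isMonoid = record
      { isSemigroup = record
        { isMagma = record
          { isEquivalence = record { refl = refl ; sym = sym ; trans = trans }
          ; ∙-cong        = ∙-cong
          }
        ; assoc = λ x y z → assoc (proj₁ x) (proj₁ y) (proj₁ z)
        }
      ; identity = (λ x → identityˡ (proj₁ x)) , (λ x → identityʳ (proj₁ x))
      }
    ; inverse = (λ x → inverseˡ (proj₁ x)) , (λ x → inverseʳ (proj₁ x))
    ; ⁻¹-cong = ⁻¹-cong
    }
  }
  where
  open Group G
  open IsSubgroup isSub

-- The quotient has the carrier of G; its equality is x ∙ y ⁻¹ ∈ N.
infixl 7 _/_
_/_ : (G : Group 0ℓ 0ℓ) → NormalSubgroup G → Group 0ℓ 0ℓ
G / N = record
  { Carrier = Carrier
  ; _≈_     = _~_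
  ; _∙_     = _∙_
  ; ε       = ε
  ; _⁻¹     = _⁻¹
  ; isGroup = record
    { isMonoid = record
      { isSemigroup = record
        { isMagma = record
          { isEquivalence = record
            { refl  = ≈⇒~ refl
            ; sym   = λ {x} {y} p → resp (inv-// x y) (⁻¹-closed p)
            ; trans = λ {x} {y} {z} p q → resp (telescope x y z) (∙-closed p q)
            }
          ; ∙-cong = λ {x} {y} {u} {v} p q →
              resp (∙-lemma x y u v) (∙-closed (conj-closed x q) p)
          }
        ; assoc = λ x y z → ≈⇒~ (assoc x y z)
        }
      ; identity = (λ x → ≈⇒~ (identityˡ x)) , (λ x → ≈⇒~ (identityʳ x))
      }
    ; inverse = (λ x → ≈⇒~ (inverseˡ x)) , (λ x → ≈⇒~ (inverseʳ x))
    ; ⁻¹-cong = λ {x} {y} p →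
        resp (⁻¹-lemma x y) (conj-closed (x ⁻¹) (resp (inv-// x y) (⁻¹-closed p)))
    }
  }
  where
  open Group G
  open NormalSubgroup N hiding (member)
  open GroupProperties G
  open ≈-Reasoning setoid

  _~_ : Rel Carrier 0ℓ
  x ~ y = x ∙ y ⁻¹ ∈ member N

  ≈⇒~ : ∀ {x y} → x ≈ y → x ~ y
  ≈⇒~ {x} {y} p = resp (sym (trans (∙-congʳ p) (inverseʳ y))) ε-closed

  inv-// : ∀ x y → (x ∙ y ⁻¹) ⁻¹ ≈ y ∙ x ⁻¹
  inv-// x y = trans (⁻¹-anti-homo-∙ x (y ⁻¹)) (∙-congʳ (⁻¹-involutive y))

  telescope : ∀ x y z → (x ∙ y ⁻¹) ∙ (y ∙ z ⁻¹) ≈ x ∙ z ⁻¹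
  telescope x y z = begin
    (x ∙ y ⁻¹) ∙ (y ∙ z ⁻¹)  ≈⟨ assoc (x ∙ y ⁻¹) y (z ⁻¹) ⟨
    (x ∙ y ⁻¹) ∙ y ∙ z ⁻¹    ≈⟨ ∙-congʳ (//-rightDividesˡ y x) ⟩
    x ∙ z ⁻¹                 ∎

  ∙-lemma : ∀ x y u v → x ∙ (u ∙ v ⁻¹) ∙ x ⁻¹ ∙ (x ∙ y ⁻¹) ≈ x ∙ u ∙ (y ∙ v) ⁻¹
  ∙-lemma x y u v = begin
    x ∙ (u ∙ v ⁻¹) ∙ x ⁻¹ ∙ (x ∙ y ⁻¹)  ≈⟨ assoc _ x (y ⁻¹) ⟨
    x ∙ (u ∙ v ⁻¹) ∙ x ⁻¹ ∙ x ∙ y ⁻¹    ≈⟨ ∙-congʳ (//-rightDividesˡ x _) ⟩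
    x ∙ (u ∙ v ⁻¹) ∙ y ⁻¹               ≈⟨ ∙-congʳ (assoc x u (v ⁻¹)) ⟨
    x ∙ u ∙ v ⁻¹ ∙ y ⁻¹                 ≈⟨ assoc (x ∙ u) (v ⁻¹) (y ⁻¹) ⟩
    x ∙ u ∙ (v ⁻¹ ∙ y ⁻¹)               ≈⟨ ∙-congˡ (⁻¹-anti-homo-∙ y v) ⟨
    x ∙ u ∙ (y ∙ v) ⁻¹                  ∎

  ⁻¹-lemma : ∀ x y → x ⁻¹ ∙ (y ∙ x ⁻¹) ∙ x ⁻¹ ⁻¹ ≈ x ⁻¹ ∙ y ⁻¹ ⁻¹
  ⁻¹-lemma x y = begin
    x ⁻¹ ∙ (y ∙ x ⁻¹) ∙ x ⁻¹ ⁻¹    ≈⟨ assoc (x ⁻¹) _ _ ⟩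
    x ⁻¹ ∙ (y ∙ x ⁻¹ ∙ x ⁻¹ ⁻¹)    ≈⟨ ∙-congˡ (//-rightDividesʳ (x ⁻¹) y) ⟩
    x ⁻¹ ∙ y                       ≈⟨ ∙-congˡ (⁻¹-involutive y) ⟨
    x ⁻¹ ∙ y ⁻¹ ⁻¹                 ∎

IsAbelian : Group 0ℓ 0ℓ → Set
IsAbelian G = AlgDefs.Commutative _≈_ _∙_ where open Group G

-- The dichotomy is doubly negated: with a bare disjunction, applying it to
-- the normal subgroup { x ∣ x ≈ ε or P } would yield ¬ P ⊎ ¬ ¬ P for every P,
-- so that not even A₅ could be shown to be simple.
-- Classically the two readings coincide, and as a hypothesis this is the
-- weaker one.
record IsSimple (G : Group 0ℓ 0ℓ) : Set₁ where
  open Group G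
  field
    nontrivial : ¬ (∀ x → x ≈ ε)
    dichotomy  : (K : NormalSubgroup G) →
                 ¬ ¬ (member K ≐ (λ x → x ≈ ε) ⊎ member K ≐ U)

Centralizer : (G : Group 0ℓ 0ℓ) → Pred (Group.Carrier G) 0ℓ → Pred (Group.Carrier G) 0ℓ
Centralizer G H a = ∀ {s} → s ∈ H → a ∙ s ≈ s ∙ a where open Group G

record IsAlmostSimple (A : Group 0ℓ 0ℓ) : Set₁ where
  open Group A
  field
    S                   : NormalSubgroup A
    S-nonabelian        : ¬ IsAbelian (subgroup A (NormalSubgroup.isSubgroup S))
    S-simple            : IsSimple (subgroup A (NormalSubgroup.isSubgroup S))
    centralizer-trivial : ∀ {a} → a ∈ Centralizer A (member S) → a ≈ ε

-- Γ = ⟨ R₀, R₁, R₂ ∣ R₀² = R₁² = R₂² = (R₀R₂)² = 1 ⟩: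
-- group terms modulo the least congruence containing the group axioms and
-- the four relations.

infixl 7 _∙_
infix  8 _⁻¹
infix  4 _≈_

data Word : Set where
  R₀ R₁ R₂ : Word
  ε        : Word
  _∙_      : Word → Word → Word
  _⁻¹      : Word → Word

data _≈_ : Rel Word 0ℓ where
  refl      : ∀ {x} → x ≈ x
  sym       : ∀ {x y} → x ≈ y → y ≈ x
  trans     : ∀ {x y z} → x ≈ y → y ≈ z → x ≈ z
  ∙-cong    : ∀ {x y u v} → x ≈ y → u ≈ v → x ∙ u ≈ y ∙ v
  ⁻¹-cong   : ∀ {x y} → x ≈ y → x ⁻¹ ≈ y ⁻¹
  assoc     : ∀ x y z → (x ∙ y) ∙ z ≈ x ∙ (y ∙ z)
  identityˡ : ∀ x → ε ∙ x ≈ x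
  identityʳ : ∀ x → x ∙ ε ≈ x
  invˡ      : ∀ x → x ⁻¹ ∙ x ≈ ε
  invʳ      : ∀ x → x ∙ x ⁻¹ ≈ ε
  R₀²       : R₀ ∙ R₀ ≈ ε
  R₁²       : R₁ ∙ R₁ ≈ ε
  R₂²       : R₂ ∙ R₂ ≈ ε
  [R₀R₂]²   : (R₀ ∙ R₂) ∙ (R₀ ∙ R₂) ≈ ε

Γ : Group 0ℓ 0ℓ
Γ = record
  { Carrier = Word
  ; _≈_     = _≈_
  ; _∙_     = _∙_
  ; ε       = ε
  ; _⁻¹     = _⁻¹
  ; isGroup = record
    { isMonoid = record
      { isSemigroup = record
        { isMagma = record
          { isEquivalence = record { refl = refl ; sym = sym ; trans = trans }
          ; ∙-cong        = ∙-cong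
          }
        ; assoc = assoc
        }
      ; identity = identityˡ , identityʳ
      }
    ; inverse = invˡ , invʳ
    ; ⁻¹-cong = ⁻¹-cong
    }
  }

open GroupMorphisms (Group.rawGroup Γ) (Group.rawGroup Γ)
  using (IsGroupHomomorphism; IsGroupIsomorphism)

-- The three involutions of V = ⟨ R₀, R₂ ⟩.
involution : Fin 3 → Word
involution 0F = R₀
involution 1F = R₂
involution 2F = R₀ ∙ R₂

-- The automorphisms of Γ that fix R₁ and permute the three involutions of V:
-- these are the elements of Σ.
record Operation : Set where
  field
    ⟦_⟧                : Word → Word
    isGroupIsomorphism : IsGroupIsomorphism ⟦_⟧
    fixes-R₁           : ⟦ R₁ ⟧ ≈ R₁
    perm               : Permutation′ 3
    permutes-V         : ∀ i → ⟦ involution i ⟧ ≈ involution (perm ⟨$⟩ʳ i)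
  open IsGroupIsomorphism isGroupIsomorphism public

open Operation using (⟦_⟧)

idᵒ : Operation
idᵒ = record
  { ⟦_⟧                = id
  ; isGroupIsomorphism = Identity.isGroupIsomorphism (Group.rawGroup Γ) refl
  ; fixes-R₁           = refl
  ; perm               = idₚ
  ; permutes-V         = λ _ → refl
  }

infixr 9 _∘ᵒ_
_∘ᵒ_ : Operation → Operation → Operation
σ ∘ᵒ τ = record
  { ⟦_⟧                = ⟦ σ ⟧ ∘ ⟦ τ ⟧
  ; isGroupIsomorphism = Composition.isGroupIsomorphism trans
                           (Operation.isGroupIsomorphism τ) σ.isGroupIsomorphism
  ; fixes-R₁           = trans (σ.⟦⟧-cong (Operation.fixes-R₁ τ)) σ.fixes-R₁
  ; perm               = Operation.perm τ ∘ₚ σ.perm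
  ; permutes-V         = λ i → trans (σ.⟦⟧-cong (Operation.permutes-V τ i))
                                     (σ.permutes-V (Operation.perm τ ⟨$⟩ʳ i))
  }
  where module σ = Operation σ

-- ρ fixes R₁ and maps R₀ ↦ R₂ ↦ R₀R₂ ↦ R₀.
ρ-map : Word → Word
ρ-map R₀      = R₂
ρ-map R₁      = R₁
ρ-map R₂      = R₀ ∙ R₂
ρ-map ε       = ε
ρ-map (x ∙ y) = ρ-map x ∙ ρ-map y
ρ-map (x ⁻¹)  = ρ-map x ⁻¹

private
  involutive⇒self-inverse : ∀ x → x ∙ x ≈ ε → x ⁻¹ ≈ x
  involutive⇒self-inverse x p = sym (GroupProperties.inverseˡ-unique Γ x x p)

R₂R₀R₂≈R₀ : R₂ ∙ (R₀ ∙ R₂) ≈ R₀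
R₂R₀R₂≈R₀ = begin
  R₂ ∙ (R₀ ∙ R₂)    ≈⟨ GroupProperties.inverseʳ-unique Γ R₀ _
                         (trans (sym (assoc R₀ R₂ (R₀ ∙ R₂))) [R₀R₂]²) ⟩
  R₀ ⁻¹             ≈⟨ involutive⇒self-inverse R₀ R₀² ⟩
  R₀                ∎
  where open ≈-Reasoning (Group.setoid Γ)

ρ-cong : ∀ {x y} → x ≈ y → ρ-map x ≈ ρ-map y
ρ-cong refl          = refl
ρ-cong (sym p)       = sym (ρ-cong p)
ρ-cong (trans p q)   = trans (ρ-cong p) (ρ-cong q)
ρ-cong (∙-cong p q)  = ∙-cong (ρ-cong p) (ρ-cong q)
ρ-cong (⁻¹-cong p)   = ⁻¹-cong (ρ-cong p)
ρ-cong (assoc x y z) = assoc (ρ-map x) (ρ-map y) (ρ-map z)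
ρ-cong (identityˡ x) = identityˡ (ρ-map x)
ρ-cong (identityʳ x) = identityʳ (ρ-map x)
ρ-cong (invˡ x)      = invˡ (ρ-map x)
ρ-cong (invʳ x)      = invʳ (ρ-map x)
ρ-cong R₀²           = R₂²
ρ-cong R₁²           = R₁²
ρ-cong R₂²           = [R₀R₂]²
ρ-cong [R₀R₂]²       = trans (∙-cong R₂R₀R₂≈R₀ R₂R₀R₂≈R₀) R₀²

ρ³≈id : ∀ x → ρ-map (ρ-map (ρ-map x)) ≈ x
ρ³≈id R₀      = R₂R₀R₂≈R₀
ρ³≈id R₁      = refl
ρ³≈id R₂      = trans (sym (assoc (R₀ ∙ R₂) R₂ _))
                  (trans (∙-cong (trans (assoc R₀ R₂ R₂)
                                   (trans (∙-cong refl R₂²) (identityʳ R₀))) refl)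
                    (trans (sym (assoc R₀ R₀ R₂))
                      (trans (∙-cong R₀² refl) (identityˡ R₂))))
ρ³≈id ε       = refl
ρ³≈id (x ∙ y) = ∙-cong (ρ³≈id x) (ρ³≈id y)
ρ³≈id (x ⁻¹)  = ⁻¹-cong (ρ³≈id x)

ρ : Operation
ρ = record
  { ⟦_⟧                = ρ-map
  ; isGroupIsomorphism = record
    { isGroupMonomorphism = record
      { isGroupHomomorphism = record
        { isMonoidHomomorphism = record
          { isMagmaHomomorphism = record
            { isRelHomomorphism = record { cong = ρ-cong }
            ; homo              = λ _ _ → refl
            }
          ; ε-homo = refl
          }
        ; ⁻¹-homo = λ _ → refl
        }
      ; injective = λ {x} {y} p →
          trans (sym (ρ³≈id x)) (trans (ρ-cong (ρ-cong p)) (ρ³≈id y))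
      }
    ; surjective = λ y → ρ-map (ρ-map y) , λ p → trans (ρ-cong p) (ρ³≈id y)
    }
  ; fixes-R₁   = refl
  ; perm       = permutation rotate rotate⁻¹ rotate-rotate⁻¹ rotate⁻¹-rotate
  ; permutes-V = λ { 0F → refl ; 1F → refl ; 2F → R₂R₀R₂≈R₀ }
  }
  where
  rotate rotate⁻¹ : Fin 3 → Fin 3
  rotate   = λ { 0F → 1F ; 1F → 2F ; 2F → 0F }
  rotate⁻¹ = λ { 0F → 2F ; 1F → 0F ; 2F → 1F }

  rotate-rotate⁻¹ : ∀ i → rotate (rotate⁻¹ i) ≡ i
  rotate-rotate⁻¹ = λ { 0F → ≡.refl ; 1F → ≡.refl ; 2F → ≡.refl }

  rotate⁻¹-rotate : ∀ i → rotate⁻¹ (rotate i) ≡ i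
  rotate⁻¹-rotate = λ { 0F → ≡.refl ; 1F → ≡.refl ; 2F → ≡.refl }

-- Equality of operations is equality of the underlying automorphisms.
infix 4 _≈ᵒ_
_≈ᵒ_ : Rel Operation 0ℓ
σ ≈ᵒ τ = ∀ g → ⟦ σ ⟧ g ≈ ⟦ τ ⟧ g

ρ^ : Fin 3 → Operation
ρ^ 0F = idᵒ
ρ^ 1F = ρ
ρ^ 2F = ρ ∘ᵒ ρ

-- The subgroup of order 3, { 1 , ρ , ρ² }.
Σ⁺ : Pred Operation 0ℓ
Σ⁺ σ = ∃ λ k → σ ≈ᵒ ρ^ k

-- A regular map is represented by its map subgroup.  The last two fields say
-- that the map has no boundary and no free edges.
record RegularMap : Set₁ where
  field
    mapSubgroup : NormalSubgroup Γ
    noConj-V    : ∀ g i → ¬ (g ∙ involution i ∙ g ⁻¹ ∈ member mapSubgroup)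
    noConj-R₁   : ∀ g → ¬ (g ∙ R₁ ∙ g ⁻¹ ∈ member mapSubgroup)

open RegularMap using (mapSubgroup)

Aut : RegularMap → Group 0ℓ 0ℓ
Aut 𝒩 = Γ / mapSubgroup 𝒩

-- Maps are isomorphic iff their map subgroups are equal.
infix 4 _≅_
_≅_ : Rel RegularMap 0ℓ
𝒩 ≅ 𝒩′ = member (mapSubgroup 𝒩) ≐ member (mapSubgroup 𝒩′)

image : Operation → Pred Word 0ℓ → Pred Word 0ℓ
image σ N g = ∃ λ n → n ∈ N × ⟦ σ ⟧ n ≈ g

imageNormal : Operation → NormalSubgroup Γ → NormalSubgroup Γ
imageNormal σ N = record
  { member     = image σ (member N)
  ; isSubgroup = record
    { resp      = λ { x≈y (n , n∈N , p) → n , n∈N , trans p x≈y }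
    ; ε-closed  = ε , N.ε-closed , σ.ε-homo
    ; ∙-closed  = λ { (n , n∈N , p) (m , m∈N , q) →
                      n ∙ m , N.∙-closed n∈N m∈N , trans (σ.∙-homo n m) (∙-cong p q) }
    ; ⁻¹-closed = λ { (n , n∈N , p) →
                      n ⁻¹ , N.⁻¹-closed n∈N , trans (σ.⁻¹-homo n) (⁻¹-cong p) }
    }
  ; conj-closed = λ { g (n , n∈N , p) →
      let (h , h↦) = σ.surjective g ; q = h↦ refl in
      h ∙ n ∙ h ⁻¹ , N.conj-closed h n∈N ,
      trans (σ.∙-homo (h ∙ n) (h ⁻¹))
        (∙-cong (trans (σ.∙-homo h n) (∙-cong q p))
                (trans (σ.⁻¹-homo h) (⁻¹-cong q))) }
  }
  where
  module σ = Operation σ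
  module N = NormalSubgroup N

infixr 8 _·_
_·_ : Operation → RegularMap → RegularMap
σ · 𝒩 = record
  { mapSubgroup = imageNormal σ (mapSubgroup 𝒩)
  ; noConj-V    = λ g i → noConj
      (trans (σ.permutes-V (σ.perm ⟨$⟩ˡ i))
             (≡⇒≈ (≡.cong involution (perm-inverseʳ σ.perm))))
      (λ h → 𝒩.noConj-V h (σ.perm ⟨$⟩ˡ i)) g
  ; noConj-R₁   = noConj σ.fixes-R₁ 𝒩.noConj-R₁
  }
  where
  module σ = Operation σ
  module 𝒩 = RegularMap 𝒩
  N = mapSubgroup 𝒩

  ≡⇒≈ : ∀ {x y} → x ≡ y → x ≈ y
  ≡⇒≈ ≡.refl = refl

  noConj : ∀ {x y} → σ.⟦ x ⟧ ≈ y → (∀ h → ¬ (h ∙ x ∙ h ⁻¹ ∈ member N)) →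
           ∀ g → ¬ (g ∙ y ∙ g ⁻¹ ∈ image σ (member N))
  noConj {x} x↦y x∉ g (n , n∈N , p) =
    let (h , h↦) = σ.surjective g ; q = h↦ refl in
    x∉ h (NormalSubgroup.resp N (σ.injective (trans p (sym
      (trans (σ.∙-homo (h ∙ x) (h ⁻¹))
        (∙-cong (trans (σ.∙-homo h x) (∙-cong q x↦y))
                (trans (σ.⁻¹-homo h) (⁻¹-cong q))))))) n∈N)

InvariantUnder : Pred Operation 0ℓ → RegularMap → Set
InvariantUnder H 𝒩 = ∀ σ → σ ∈ H → σ · 𝒩 ≅ 𝒩

record OrbitHasSize (n : ℕ) (𝒩 : RegularMap) : Set where
  field
    rep      : Fin n → Operation
    distinct : ∀ {i j} → i ≢ j → ¬ (rep i · 𝒩 ≅ rep j · 𝒩)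
    complete : ∀ σ → ∃ λ i → σ · 𝒩 ≅ rep i · 𝒩

ClassI : RegularMap → Set
ClassI = OrbitHasSize 6

ClassIII : RegularMap → Set
ClassIII = OrbitHasSize 2

-- The map with map subgroup ⋂_{σ ∈ Σ⁺} σ(N).
infix 9 _Σ⁺-core
_Σ⁺-core : RegularMap → RegularMap
𝒩 Σ⁺-core = record
  { mapSubgroup = record
    { member     = λ g → ∀ σ → σ ∈ Σ⁺ → g ∈ image σ (member N)
    ; isSubgroup = record
      { resp      = λ x≈y x∈ σ s → σN.resp σ x≈y (x∈ σ s)
      ; ε-closed  = λ σ _ → σN.ε-closed σ
      ; ∙-closed  = λ x∈ y∈ σ s → σN.∙-closed σ (x∈ σ s) (y∈ σ s)
      ; ⁻¹-closed = λ x∈ σ s → σN.⁻¹-closed σ (x∈ σ s)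
      }
    ; conj-closed = λ g x∈ σ s → σN.conj-closed σ g (x∈ σ s)
    }
  ; noConj-V  = λ g i x∈ → RegularMap.noConj-V 𝒩 g i (⊆N x∈)
  ; noConj-R₁ = λ g x∈ → RegularMap.noConj-R₁ 𝒩 g (⊆N x∈)
  }
  where
  N = mapSubgroup 𝒩
  module σN (σ : Operation) = NormalSubgroup (imageNormal σ N)

  ⊆N : ∀ {g} → (∀ σ → σ ∈ Σ⁺ → g ∈ image σ (member N)) → g ∈ member N
  ⊆N x∈ = let (n , n∈N , p) = x∈ idᵒ (0F , λ _ → refl) in NormalSubgroup.resp N p n∈N

{-# OPTIONS --safe #-}

-- If Γ / N is almost simple with socle S, then every normal subgroup of Γ not
-- contained in N covers S, and S is not abelian; so two such subgroups have
-- [L₁ , L₂] ⊈ N and hence L₁ ∩ L₂ ⊈ N.  For an odd operation π the image of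
-- the Σ⁺-core under π is the intersection of the three groups π ρᵏ (N).
-- If it were the core again, it would lie in N, so some π ρᵏ (N) would lie
-- in N.  But π ρᵏ is an involution, so this forces π ρᵏ (N) = N, against
-- class I.

module Submission where

open import Defs
  using (IsSubgroup; NormalSubgroup; subgroup; _/_; IsSimple; IsAlmostSimple)
open import Level using (0ℓ)
open import Algebra.Bundles using (Group)
import Algebra.Properties.Group as GroupProperties
open import Data.Fin.Base using (Fin; splitAt; _↑ʳ_; punchOut)
open import Data.Fin.Patterns using (0F; 1F; 2F)
open import Data.Fin.Permutation using (permutation; _⟨$⟩ʳ_)
open import Data.Fin.Properties using (_≟_; all?; any?; pigeonhole; punchOut-injective; <⇒≢)
open import Data.Nat.Properties using (n<1+n)
open import Data.Product.Base using (∃; _×_; _,_; proj₁; proj₂)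
open import Data.Sum.Base using (inj₁; inj₂; [_,_]′)
open import Function.Base using (_∘_)
open import Function.Bundles using (Injection)
open import Function.Properties.Inverse using (↔⇒↣)
open import Relation.Binary.PropositionalEquality.Core as ≡ using (_≡_; _≢_)
open import Relation.Nullary.Decidable using (Dec; yes; no; from-yes; ¬?; _×-dec_; _→-dec_)
open import Relation.Nullary.Negation.Core using (¬_; contradiction)
open import Relation.Unary using (_∈_; _⊆_; _∩_; _≐_; U)
open import Relation.Unary.Properties using (≐-refl; ≐-sym; ≐-trans)

open NormalSubgroup using (member)

-- Normal subgroups: intersections, commutators, images in quotients

module _ {G : Group 0ℓ 0ℓ} where
  open Group G
  open GroupProperties G

  ∩-normal : NormalSubgroup G → NormalSubgroup G → NormalSubgroup G
  ∩-normal K L = record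
    { member     = member K ∩ member L
    ; isSubgroup = record
      { resp      = λ x≈y (x∈K , x∈L) → K.resp x≈y x∈K , L.resp x≈y x∈L
      ; ε-closed  = K.ε-closed , L.ε-closed
      ; ∙-closed  = λ (x∈K , x∈L) (y∈K , y∈L) → K.∙-closed x∈K y∈K , L.∙-closed x∈L y∈L
      ; ⁻¹-closed = λ (x∈K , x∈L) → K.⁻¹-closed x∈K , L.⁻¹-closed x∈L
      }
    ; conj-closed = λ g (x∈K , x∈L) → K.conj-closed g x∈K , L.conj-closed g x∈L
    }
    where
    module K = NormalSubgroup K
    module L = NormalSubgroup L

  -- The commutator has this form because, in a quotient, `x ∙ y ≈ y ∙ x` unfolds to membership of
  -- exactly this word in the kernel.
  commutator∈∩ : ∀ (K L : NormalSubgroup G) {x y} → x ∈ member K → y ∈ member L →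
                 x ∙ y ∙ (y ∙ x) ⁻¹ ∈ member K ∩ member L
  commutator∈∩ K L {x} {y} x∈K y∈L =
    K.resp (sym lemma) (K.∙-closed x∈K (K.conj-closed y (K.⁻¹-closed x∈K))) ,
    L.resp (sym lemma′) (L.∙-closed (L.conj-closed x y∈L) (L.⁻¹-closed y∈L))
    where
    module K = NormalSubgroup K
    module L = NormalSubgroup L

    lemma′ : x ∙ y ∙ (y ∙ x) ⁻¹ ≈ x ∙ y ∙ x ⁻¹ ∙ y ⁻¹
    lemma′ = trans (∙-congˡ (⁻¹-anti-homo-∙ y x)) (sym (assoc (x ∙ y) (x ⁻¹) (y ⁻¹)))

    lemma : x ∙ y ∙ (y ∙ x) ⁻¹ ≈ x ∙ (y ∙ x ⁻¹ ∙ y ⁻¹)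
    lemma = trans lemma′ (trans (∙-congʳ (assoc x y (x ⁻¹))) (assoc x (y ∙ x ⁻¹) (y ⁻¹)))

  restrict : ∀ {H} (H≤G : IsSubgroup G H) → NormalSubgroup G → NormalSubgroup (subgroup G H≤G)
  restrict H≤G L = record
    { member      = member L ∘ proj₁
    ; isSubgroup  = record
      { resp = L.resp ; ε-closed = L.ε-closed ; ∙-closed = L.∙-closed ; ⁻¹-closed = L.⁻¹-closed }
    ; conj-closed = λ g → L.conj-closed (proj₁ g)
    }
    where module L = NormalSubgroup L

  -- The full preimage of the image of L, that is L N.
  imageInQuotient : (N L : NormalSubgroup G) → NormalSubgroup (G / N)
  imageInQuotient N L = record
    { member     = λ g → ∃ λ l → l ∈ member L × Q._≈_ g l
    ; isSubgroup = record
      { resp      = λ g~h (l , l∈L , g~l) → l , l∈L , Q.trans (Q.sym g~h) g~l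
      ; ε-closed  = ε , L.ε-closed , Q.refl
      ; ∙-closed  = λ (l , l∈L , g~l) (m , m∈L , h~m) → l ∙ m , L.∙-closed l∈L m∈L , Q.∙-cong g~l h~m
      ; ⁻¹-closed = λ (l , l∈L , g~l) → l ⁻¹ , L.⁻¹-closed l∈L , Q.⁻¹-cong g~l
      }
    ; conj-closed = λ g (l , l∈L , h~l) →
        g ∙ l ∙ g ⁻¹ , L.conj-closed g l∈L , Q.∙-cong (Q.∙-cong (Q.refl {g}) h~l) (Q.refl {g ⁻¹})
    }
    where
    module L = NormalSubgroup L
    module Q = Group (G / N)

-- Almost simple groups

module _ {A : Group 0ℓ 0ℓ} (A-almostSimple : IsAlmostSimple A) where
  open Group A
  open GroupProperties A
  open IsAlmostSimple A-almostSimple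
  open NormalSubgroup S using (isSubgroup)

  -- `L ∩ S` is normal in the simple group `S`. If it is trivial, so are all commutators of `L` with
  -- `S`, which puts `L` in the trivial centralizer of `S`; otherwise it is all of `S`. The double
  -- negation is inherited from `dichotomy`.
  socle⊆nontrivial : (L : NormalSubgroup A) → ¬ (member L ⊆ (_≈ ε)) → ¬ ¬ (member S ⊆ member L)
  socle⊆nontrivial L L≠1 S⊈L =
    IsSimple.dichotomy S-simple (restrict isSubgroup L) λ where
      (inj₁ (L∩S⊆1 , _)) → L≠1 λ {l} l∈L → centralizer-trivial λ {s} s∈S →
        let ([l,s]∈L , [l,s]∈S) = commutator∈∩ L S l∈L s∈S
        in x∙y⁻¹≈ε⇒x≈y (l ∙ s) (s ∙ l) (L∩S⊆1 {_ , [l,s]∈S} [l,s]∈L)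
      (inj₂ (_ , S⊆L)) → S⊈L λ {s} s∈S → S⊆L {s , s∈S} _

  -- Otherwise both subgroups would contain `S`, whose elements would then commute with one another.
  commuting⇒trivial : (K L : NormalSubgroup A) →
    (∀ {x y} → x ∈ member K → y ∈ member L → x ∙ y ≈ y ∙ x) →
    ¬ (member K ⊆ (_≈ ε)) → ¬ ¬ (member L ⊆ (_≈ ε))
  commuting⇒trivial K L comm K≠1 L≠1 =
    socle⊆nontrivial K K≠1 λ S⊆K → socle⊆nontrivial L L≠1 λ S⊆L →
    S-nonabelian λ x y → comm (S⊆K (proj₂ x)) (S⊆L (proj₂ y))

module _ {G : Group 0ℓ 0ℓ} (N : NormalSubgroup G) (G/N-almostSimple : IsAlmostSimple (G / N)) where
  open Group G
  open GroupProperties G using (ε⁻¹≈ε)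
  private
    module N = NormalSubgroup N
    module Q = Group (G / N)

  -- Commutators of `K` with `L` lie in the intersection. If that lies in `N`, the images of `K` and
  -- `L` in `G / N` commute, so they cannot both be nontrivial.
  ∩⊈ : (K L : NormalSubgroup G) → ¬ (member K ⊆ member N) → ¬ (member L ⊆ member N) →
       ¬ (member K ∩ member L ⊆ member N)
  ∩⊈ K L K⊈N L⊈N K∩L⊆N =
    commuting⇒trivial G/N-almostSimple (imageInQuotient N K) (imageInQuotient N L) commute
      (K⊈N ∘ trivial⇒⊆ K) (L⊈N ∘ trivial⇒⊆ L)
    where
    trivial⇒⊆ : (L : NormalSubgroup G) → member (imageInQuotient N L) ⊆ (Q._≈ ε) →
                member L ⊆ member N
    trivial⇒⊆ L triv {l} l∈L =
      N.resp (trans (∙-congˡ ε⁻¹≈ε) (identityʳ l)) (triv (l , l∈L , Q.refl {l}))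

    commute : ∀ {x y} → x ∈ member (imageInQuotient N K) → y ∈ member (imageInQuotient N L) →
              Q._≈_ (x ∙ y) (y ∙ x)
    commute (k , k∈K , x~k) (l , l∈L , y~l) =
      Q.trans (Q.∙-cong x~k y~l)
        (Q.trans (K∩L⊆N (commutator∈∩ K L k∈K l∈L)) (Q.sym (Q.∙-cong y~l x~k)))

-- The six operations, from Petrie duality and `ρ`

open import Defs
open Operation using (⟦_⟧)
open RegularMap using (mapSubgroup)

≡⇒≈ : ∀ {x y} → x ≡ y → x ≈ y
≡⇒≈ ≡.refl = refl

R₀R₂R₂≈R₀ : R₀ ∙ R₂ ∙ R₂ ≈ R₀
R₀R₂R₂≈R₀ = trans (assoc R₀ R₂ R₂) (trans (∙-cong refl R₂²) (identityʳ R₀))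

-- π is Petrie duality: it fixes R₁ and R₂ and swaps R₀ with R₀R₂.
π-map : Word → Word
π-map R₀      = R₀ ∙ R₂
π-map R₁      = R₁
π-map R₂      = R₂
π-map ε       = ε
π-map (x ∙ y) = π-map x ∙ π-map y
π-map (x ⁻¹)  = π-map x ⁻¹

π-cong : ∀ {x y} → x ≈ y → π-map x ≈ π-map y
π-cong refl          = refl
π-cong (sym p)       = sym (π-cong p)
π-cong (trans p q)   = trans (π-cong p) (π-cong q)
π-cong (∙-cong p q)  = ∙-cong (π-cong p) (π-cong q)
π-cong (⁻¹-cong p)   = ⁻¹-cong (π-cong p)
π-cong (assoc x y z) = assoc (π-map x) (π-map y) (π-map z)
π-cong (identityˡ x) = identityˡ (π-map x)
π-cong (identityʳ x) = identityʳ (π-map x)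
π-cong (invˡ x)      = invˡ (π-map x)
π-cong (invʳ x)      = invʳ (π-map x)
π-cong R₀²           = [R₀R₂]²
π-cong R₁²           = R₁²
π-cong R₂²           = R₂²
π-cong [R₀R₂]²       = trans (∙-cong R₀R₂R₂≈R₀ R₀R₂R₂≈R₀) R₀²

π²≈id : ∀ x → π-map (π-map x) ≈ x
π²≈id R₀      = R₀R₂R₂≈R₀
π²≈id R₁      = refl
π²≈id R₂      = refl
π²≈id ε       = refl
π²≈id (x ∙ y) = ∙-cong (π²≈id x) (π²≈id y)
π²≈id (x ⁻¹)  = ⁻¹-cong (π²≈id x)

π : Operation
π = record
  { ⟦_⟧                = π-map
  ; isGroupIsomorphism = record
    { isGroupMonomorphism = record
      { isGroupHomomorphism = record
        { isMonoidHomomorphism = record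
          { isMagmaHomomorphism = record
            { isRelHomomorphism = record { cong = π-cong }
            ; homo              = λ _ _ → refl
            }
          ; ε-homo = refl
          }
        ; ⁻¹-homo = λ _ → refl
        }
      ; injective = λ {x} {y} p → trans (sym (π²≈id x)) (trans (π-cong p) (π²≈id y))
      }
    ; surjective = λ y → π-map y , λ p → trans (π-cong p) (π²≈id y)
    }
  ; fixes-R₁   = refl
  ; perm       = permutation swap swap swap-swap swap-swap
  ; permutes-V = λ { 0F → refl ; 1F → refl ; 2F → R₀R₂R₂≈R₀ }
  }
  where
  swap : Fin 3 → Fin 3
  swap = λ { 0F → 2F ; 1F → 1F ; 2F → 0F }

  swap-swap : ∀ i → swap (swap i) ≡ i
  swap-swap = λ { 0F → ≡.refl ; 1F → ≡.refl ; 2F → ≡.refl }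

action : Operation → Fin 3 → Fin 3
action σ i = Operation.perm σ ⟨$⟩ʳ i

action-injective : ∀ σ {i j} → action σ i ≡ action σ j → i ≡ j
action-injective σ p = Injection.injective (↔⇒↣ (Operation.perm σ)) p

-- Two values suffice: `R₀` and `R₂` generate `V`, and every operation fixes `R₁`.
Agree : (f g : Fin 3 → Fin 3) → Set
Agree f g = f 0F ≡ g 0F × f 1F ≡ g 1F

agree? : ∀ f g → Dec (Agree f g)
agree? f g = (f 0F ≟ g 0F) ×-dec (f 1F ≟ g 1F)

-- Homomorphisms that agree on generators agree on all words. Identities between operations thus
-- reduce to finite checks on `Fin 3`, settled by evaluation.
agree⇒≈ᵒ : ∀ σ τ → Agree (action σ) (action τ) → σ ≈ᵒ τ
agree⇒≈ᵒ σ τ (p , q) = go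
  where
  module σ = Operation σ
  module τ = Operation τ

  on-V : ∀ i → action σ i ≡ action τ i → σ.⟦ involution i ⟧ ≈ τ.⟦ involution i ⟧
  on-V i r = trans (σ.permutes-V i) (trans (≡⇒≈ (≡.cong involution r)) (sym (τ.permutes-V i)))

  go : σ ≈ᵒ τ
  go R₀      = on-V 0F p
  go R₁      = trans σ.fixes-R₁ (sym τ.fixes-R₁)
  go R₂      = on-V 1F q
  go ε       = trans σ.ε-homo (sym τ.ε-homo)
  go (x ∙ y) = trans (σ.∙-homo x y) (trans (∙-cong (go x) (go y)) (sym (τ.∙-homo x y)))
  go (x ⁻¹)  = trans (σ.⁻¹-homo x) (trans (⁻¹-cong (go x)) (sym (τ.⁻¹-homo x)))

-- Indices 0 to 2 run through `Σ⁺`, indices 3 to 5 through its coset by `π`.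
op : Fin 6 → Operation
op i = [ ρ^ , (λ k → π ∘ᵒ ρ^ k) ]′ (splitAt 3 i)

classify : ∀ σ → ∃ λ i → σ ≈ᵒ op i
classify σ =
  let (i , p) = table (action σ 0F) (action σ 1F) (λ p → contradiction (action-injective σ p) λ ())
  in i , agree⇒≈ᵒ σ (op i) p
  where
  -- There are six pairs of distinct values, one for each of the six operations.
  table : ∀ p q → p ≢ q → ∃ λ i → p ≡ action (op i) 0F × q ≡ action (op i) 1F
  table = from-yes (all? λ p → all? λ q → ¬? (p ≟ q) →-dec
    any? λ i → (p ≟ action (op i) 0F) ×-dec (q ≟ action (op i) 1F))

-- In S₃ the elements outside the subgroup of order 3 are transpositions.
πρ^-involutive : ∀ k → (π ∘ᵒ ρ^ k) ∘ᵒ (π ∘ᵒ ρ^ k) ≈ᵒ idᵒ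
πρ^-involutive k = agree⇒≈ᵒ ((π ∘ᵒ ρ^ k) ∘ᵒ (π ∘ᵒ ρ^ k)) idᵒ (table k)
  where
  table : ∀ k → Agree (action ((π ∘ᵒ ρ^ k) ∘ᵒ (π ∘ᵒ ρ^ k))) (action idᵒ)
  table = from-yes (all? λ k → agree? (action ((π ∘ᵒ ρ^ k) ∘ᵒ (π ∘ᵒ ρ^ k))) (action idᵒ))

ρ^-∘ : ∀ j k → ∃ λ i → ρ^ j ∘ᵒ ρ^ k ≈ᵒ ρ^ i
ρ^-∘ j k = let (i , p) = table j k in i , agree⇒≈ᵒ (ρ^ j ∘ᵒ ρ^ k) (ρ^ i) p
  where
  table : ∀ j k → ∃ λ i → Agree (action (ρ^ j ∘ᵒ ρ^ k)) (action (ρ^ i))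
  table = from-yes (all? λ j → all? λ k → any? λ i →
    agree? (action (ρ^ j ∘ᵒ ρ^ k)) (action (ρ^ i)))

-- With `ρ^-∘`, this makes composition with `ρ^ j` map `Σ⁺` onto itself, as reindexing the core
-- requires.
ρ^-divide : ∀ j i → ∃ λ k → ρ^ j ∘ᵒ ρ^ k ≈ᵒ ρ^ i
ρ^-divide j i = let (k , p) = table j i in k , agree⇒≈ᵒ (ρ^ j ∘ᵒ ρ^ k) (ρ^ i) p
  where
  table : ∀ j i → ∃ λ k → Agree (action (ρ^ j ∘ᵒ ρ^ k)) (action (ρ^ i))
  table = from-yes (all? λ j → all? λ i → any? λ k →
    agree? (action (ρ^ j ∘ᵒ ρ^ k)) (action (ρ^ i)))

-- Images of subgroups under operations

image-resp-⊆ : ∀ σ τ {P} → σ ≈ᵒ τ → image σ P ⊆ image τ P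
image-resp-⊆ σ τ σ≈τ (n , n∈P , p) = n , n∈P , trans (sym (σ≈τ n)) p

image-resp : ∀ σ τ {P} → σ ≈ᵒ τ → image σ P ≐ image τ P
image-resp σ τ σ≈τ = image-resp-⊆ σ τ σ≈τ , image-resp-⊆ τ σ (sym ∘ σ≈τ)

image-mono : ∀ σ {P Q} → P ⊆ Q → image σ P ⊆ image σ Q
image-mono σ P⊆Q (n , n∈P , p) = n , P⊆Q n∈P , p

image-∘ : ∀ σ τ {P} → image (σ ∘ᵒ τ) P ≐ image σ (image τ P)
image-∘ σ τ =
  (λ (n , n∈P , p) → ⟦ τ ⟧ n , (n , n∈P , refl) , p) ,
  (λ (m , (n , n∈P , q) , p) → n , n∈P , trans (Operation.⟦⟧-cong σ q) p)

id-≅ : ∀ 𝒩 → idᵒ · 𝒩 ≅ 𝒩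
id-≅ 𝒩 = (λ (n , n∈N , p) → NormalSubgroup.resp (mapSubgroup 𝒩) p n∈N) , λ n∈N → _ , n∈N , refl

-- Applying `σ` to the inclusion yields the reverse one, since `n` is the image of `⟦ σ ⟧ n`.
involution-⊆⇒≅ : ∀ σ 𝒩 → σ ∘ᵒ σ ≈ᵒ idᵒ →
  image σ (member (mapSubgroup 𝒩)) ⊆ member (mapSubgroup 𝒩) → σ · 𝒩 ≅ 𝒩
involution-⊆⇒≅ σ 𝒩 σ²≈id σN⊆N =
  σN⊆N , λ {n} n∈N → ⟦ σ ⟧ n , σN⊆N (n , n∈N , refl) , σ²≈id n

-- Were two of the six operations to have the same image, the six distinct
-- images of a map in class I would inject into a set of five.
classI⇒distinct : ∀ {𝒩} → ClassI 𝒩 → ∀ {i j} → i ≢ j → ¬ (op i · 𝒩 ≅ op j · 𝒩)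
classI⇒distinct {𝒩} 𝒩∈I {c} {d} c≢d c≅d =
  let (i , j , i<j , same) = pigeonhole (n<1+n 5) (punchOut ∘ c≢merge ∘ index)
  in distinct (<⇒≢ i<j) (≐-trans (rep≅ i) (≐-sym (≡.subst (λ k → rep j · 𝒩 ≅ op k · 𝒩)
       (≡.sym (punchOut-injective (c≢merge (index i)) (c≢merge (index j)) same)) (rep≅ j))))
  where
  open OrbitHasSize 𝒩∈I

  index : Fin 6 → Fin 6
  index i = proj₁ (classify (rep i))

  -- Redirecting `c` to `d` frees the value `c`, so that `punchOut` can land in `Fin 5`.
  merge : Fin 6 → Fin 6
  merge k with c ≟ k
  ... | yes _ = d
  ... | no  _ = k

  c≢merge : ∀ k → c ≢ merge k
  c≢merge k with c ≟ k
  ... | yes _  = c≢d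
  ... | no c≢k = c≢k

  merge≅ : ∀ k → op k · 𝒩 ≅ op (merge k) · 𝒩
  merge≅ k with c ≟ k
  ... | yes ≡.refl = c≅d
  ... | no _       = ≐-refl

  rep≅ : ∀ i → rep i · 𝒩 ≅ op (merge (index i)) · 𝒩
  rep≅ i = ≐-trans (image-resp (rep i) (op (index i)) (proj₂ (classify (rep i)))) (merge≅ (index i))

-- The `Σ⁺`-core and its orbit

module _ (𝒩 : RegularMap) where
  private
    N = mapSubgroup 𝒩
    M = mapSubgroup (𝒩 Σ⁺-core)

  -- A bijection commutes with intersections: by injectivity of `σ`, one preimage of `g` serves
  -- every `k`.
  image-core : ∀ σ → image σ (member M) ≐ (λ g → ∀ k → g ∈ image (σ ∘ᵒ ρ^ k) (member N))
  image-core σ = to , from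
    where
    module σ = Operation σ

    to : image σ (member M) ⊆ (λ g → ∀ k → g ∈ image (σ ∘ᵒ ρ^ k) (member N))
    to (n , n∈M , p) k =
      let (m , m∈N , q) = n∈M (ρ^ k) (k , λ _ → refl)
      in m , m∈N , trans (σ.⟦⟧-cong q) p

    from : (λ g → ∀ k → g ∈ image (σ ∘ᵒ ρ^ k) (member N)) ⊆ image σ (member M)
    from {g} g∈ =
      let (n , n↦) = σ.surjective g
      in n ,
         (λ υ (k , υ≈ρ^k) →
            let (m , m∈N , q) = g∈ k
            in m , m∈N , trans (υ≈ρ^k m) (σ.injective (trans q (sym (n↦ refl))))) ,
         n↦ refl

  -- Composition with `ρ^ j` only permutes the three groups being intersected.
  core-invariant : InvariantUnder Σ⁺ (𝒩 Σ⁺-core)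
  core-invariant σ (j , σ≈ρ^j) =
    ≐-trans (image-resp σ (ρ^ j) σ≈ρ^j) (≐-trans (image-core (ρ^ j))
      -- `image-core idᵒ` applies because `idᵒ ∘ᵒ ρ^ k` and `ρ^ k` have the same underlying map by
      -- computation.
      (≐-trans reindex (≐-trans (≐-sym (image-core idᵒ)) (id-≅ (𝒩 Σ⁺-core)))))
    where
    reindex : (λ g → ∀ k → g ∈ image (ρ^ j ∘ᵒ ρ^ k) (member N)) ≐
              (λ g → ∀ k → g ∈ image (ρ^ k) (member N))
    reindex =
      (λ g∈ i → let (k , e) = ρ^-divide j i in image-resp-⊆ (ρ^ j ∘ᵒ ρ^ k) (ρ^ i) e (g∈ k)) ,
      (λ g∈ k → let (i , e) = ρ^-∘ j k in image-resp-⊆ (ρ^ i) (ρ^ j ∘ᵒ ρ^ k) (sym ∘ e) (g∈ i))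

  core-not-π-invariant : ClassI 𝒩 → IsAlmostSimple (Aut 𝒩) → ¬ (π · 𝒩 Σ⁺-core ≅ 𝒩 Σ⁺-core)
  core-not-π-invariant 𝒩∈I almostSimple (πM⊆M , _) =
    -- The triple intersection is nested as 0 with (1 with 2), so `∩⊈` is applied twice.
    ∩⊈ N almostSimple (πρ^N 0F) (∩-normal (πρ^N 1F) (πρ^N 2F)) (πρ^N⊈N 0F)
      (∩⊈ N almostSimple (πρ^N 1F) (πρ^N 2F) (πρ^N⊈N 1F) (πρ^N⊈N 2F))
      λ (g∈₀ , g∈₁ , g∈₂) → M⊆N (πM⊆M (proj₂ (image-core π)
        λ { 0F → g∈₀ ; 1F → g∈₁ ; 2F → g∈₂ }))
    where
    πρ^N : Fin 3 → NormalSubgroup Γ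
    πρ^N k = imageNormal (π ∘ᵒ ρ^ k) N

    πρ^N⊈N : ∀ k → ¬ (member (πρ^N k) ⊆ member N)
    πρ^N⊈N k πρ^N⊆N =
      -- `3 ↑ʳ k` is the index of `π ∘ᵒ ρ^ k` in `op`, and `0F` that of the identity.
      classI⇒distinct 𝒩∈I {3 ↑ʳ k} {0F} (λ ())
        (≐-trans (involution-⊆⇒≅ (π ∘ᵒ ρ^ k) 𝒩 (πρ^-involutive k) πρ^N⊆N) (≐-sym (id-≅ 𝒩)))

    M⊆N : member M ⊆ member N
    M⊆N g∈M = proj₁ (id-≅ 𝒩) (g∈M idᵒ (0F , λ _ → refl))

  core-classIII : ClassI 𝒩 → IsAlmostSimple (Aut 𝒩) → ClassIII (𝒩 Σ⁺-core)
  core-classIII 𝒩∈I almostSimple = record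
    { rep      = rep
    ; distinct = distinct
    ; complete = complete
    }
    where
    rep : Fin 2 → Operation
    rep 0F = idᵒ
    rep 1F = π

    π≇id : ¬ (π · 𝒩 Σ⁺-core ≅ idᵒ · 𝒩 Σ⁺-core)
    π≇id p = core-not-π-invariant 𝒩∈I almostSimple (≐-trans p (id-≅ (𝒩 Σ⁺-core)))

    distinct : ∀ {i j} → i ≢ j → ¬ (rep i · 𝒩 Σ⁺-core ≅ rep j · 𝒩 Σ⁺-core)
    distinct {0F} {0F} 0≢0 = contradiction ≡.refl 0≢0
    distinct {0F} {1F} _   = π≇id ∘ ≐-sym
    distinct {1F} {0F} _   = π≇id
    distinct {1F} {1F} 1≢1 = contradiction ≡.refl 1≢1

    complete : ∀ σ → ∃ λ i → σ · 𝒩 Σ⁺-core ≅ rep i · 𝒩 Σ⁺-core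
    complete σ with classify σ
    ... | i , σ≈ with splitAt 3 i
    ... | inj₁ k = 0F , ≐-trans (core-invariant σ (k , σ≈)) (≐-sym (id-≅ (𝒩 Σ⁺-core)))
    ... | inj₂ k =
      -- Here σ is `π ∘ᵒ ρ^ k`, and `ρ^ k` already fixes the core, so only `π` acts.
      let ρ^kM⊆M , M⊆ρ^kM = core-invariant (ρ^ k) (k , λ _ → refl)
      in 1F , ≐-trans (image-resp σ (π ∘ᵒ ρ^ k) σ≈)
                (≐-trans (image-∘ π (ρ^ k)) (image-mono π ρ^kM⊆M , image-mono π M⊆ρ^kM))

theorem5p2 : (𝒩 : RegularMap) → ClassI 𝒩 → IsAlmostSimple (Aut 𝒩) →
    ClassIII (𝒩 Σ⁺-core) ×
    (InvariantUnder Σ⁺ (𝒩 Σ⁺-core) × ¬ InvariantUnder U (𝒩 Σ⁺-core))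
theorem5p2 𝒩 𝒩∈I almostSimple =
  core-classIII 𝒩 𝒩∈I almostSimple ,
  core-invariant 𝒩 ,
  λ invariant → core-not-π-invariant 𝒩 𝒩∈I almostSimple (invariant π _)
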